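{- Every $N$-free poset without infinite antichains is a linear sum or a disjoint sum of $N$-free posets without infinite antichains.
   Context: Posets are not necessarily finite. An antichain is a set of pairwise incomparable elements. A $4$-tuple $(a,b,c,d)$ of distinct elements of a poset $P$ is an $N$ in $P$ if $a<b$, $c<b$, $c<d$, and these are the only strict comparabilities among $a,b,c,d$. $P$ is $N$-free if it does not contain an $N$. Let $I$ be a poset with $|I|\geq 2$ and $\{P_i\}_{i\in I}$ a family of pairwise disjoint nonempty posets that are all disjoint from $I$. The lexicographical sum $\sum_{i\in I}P_i$ is the poset on $\bigcup_{i\in I}P_i$ in which $x\le y$ if and only if either there is $i\in I$ with $x,y\in P_i$ and $x\le y$ in $P_i$, or there are distinct $i,j\in I$ with $i<j$ in $I$, $x\in P_i$ and $y\in P_j$. It is called a linear sum if $I$ is totally ordered, and a disjoint sum if $I$ is an antichain.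
   Formalization: The poset is assumed to have at least two elements; the empty and one-element posets are N-free without infinite antichains but are not sums, since a sum has at least two nonempty summands. -}

module Defs where

open import Data.List.Base using (List)
open import Data.Product.Base using (Σ; ∃; ∃₂; _×_; _,_)
open import Level using (Level; _⊔_; suc)
open import Relation.Binary.Bundles using (Poset)
open import Relation.Binary.Core using (Rel)
open import Relation.Binary.Definitions using (Total)
open import Relation.Binary.Morphism.Structures using (IsOrderIsomorphism)
open import Relation.Binary.PropositionalEquality.Core using (_≡_; _≢_; refl)
open import Relation.Binary.Structures using (IsPartialOrder)
open import Relation.Nullary.Negation.Core using (¬_; contradiction)
open import Relation.Unary using (Pred; _∈_; U)
import Data.List.Membership.Setoid as SetoidMembership
import Relation.Binary.Properties.Poset as PosetProperties

private
  variable
    a i c ℓᵢ ℓ ℓ₁ ℓ₂ : Level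

module _ (P : Poset c ℓ₁ ℓ₂) where
  open Poset P
  open PosetProperties P using (_<_)
  open SetoidMembership Eq.setoid using () renaming (_∈_ to _∈ˡ_)

  -- Required of the index of a lexicographical sum. Since the summands are
  -- nonempty, every such sum then has two elements as well, so the empty and the
  -- one-element poset are never sums.
  AtLeastTwo : Set (c ⊔ ℓ₁)
  AtLeastTwo = ∃₂ λ x y → ¬ (x ≈ y)

  Incomparable : Rel Carrier ℓ₂
  Incomparable x y = ¬ (x ≤ y) × ¬ (y ≤ x)

  IsAntichain : Pred Carrier ℓ → Set (c ⊔ ℓ₁ ⊔ ℓ₂ ⊔ ℓ)
  IsAntichain S = ∀ {x y} → x ∈ S → y ∈ S → ¬ (x ≈ y) → Incomparable x y

  Finite : Pred Carrier ℓ → Set (c ⊔ ℓ₁ ⊔ ℓ)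
  Finite S = ∃ λ (xs : List Carrier) → ∀ {x} → x ∈ S → x ∈ˡ xs

  Infinite : Pred Carrier ℓ → Set (c ⊔ ℓ₁ ⊔ ℓ)
  Infinite S = ¬ Finite S

  NoInfiniteAntichain : Set (suc (c ⊔ ℓ₁ ⊔ ℓ₂))
  NoInfiniteAntichain =
    ¬ ∃ λ (S : Pred Carrier (c ⊔ ℓ₁ ⊔ ℓ₂)) → IsAntichain S × Infinite S

  -- Distinctness of the four elements follows: _<_ entails ¬ (x ≈ y), and so
  -- does Incomparable, by reflexivity.
  record IsN (x y z w : Carrier) : Set (c ⊔ ℓ₁ ⊔ ℓ₂) where
    field
      x<y : x < y
      z<y : z < y
      z<w : z < w
      x∥z : Incomparable x z
      x∥w : Incomparable x w
      y∥w : Incomparable y w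

  NFree : Set (c ⊔ ℓ₁ ⊔ ℓ₂)
  NFree = ∀ x y z w → ¬ IsN x y z w

-- Equality of indices is propositional, so that a family of posets over the
-- index set needs no compatibility data.
record IndexPoset (i ℓᵢ : Level) : Set (suc (i ⊔ ℓᵢ)) where
  field
    Index          : Set i
    _≤ᵢ_           : Rel Index ℓᵢ
    isPartialOrder : IsPartialOrder _≡_ _≤ᵢ_

  poset : Poset i i ℓᵢ
  poset = record { isPartialOrder = isPartialOrder }

-- Pairwise disjointness of the summands is achieved by tagging: the union is
-- the type of pairs (i , x) with x an element of the i-th summand.
module _ (I : IndexPoset i ℓᵢ) (F : IndexPoset.Index I → Poset c ℓ₁ ℓ₂) where
  open IndexPoset I using (Index; _≤ᵢ_)
  private
    module I = IsPartialOrder (IndexPoset.isPartialOrder I)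
    module F k = Poset (F k)

  Union : Set (i ⊔ c)
  Union = Σ Index F.Carrier

  data _≈ₗ_ : Rel Union (i ⊔ c ⊔ ℓ₁) where
    same : ∀ {k} {x y : F.Carrier k} → F._≈_ k x y → (k , x) ≈ₗ (k , y)

  data _≤ₗ_ : Rel Union (i ⊔ ℓᵢ ⊔ c ⊔ ℓ₂) where
    within : ∀ {k} {x y : F.Carrier k} → F._≤_ k x y → (k , x) ≤ₗ (k , y)
    across : ∀ {k l} {x : F.Carrier k} {y : F.Carrier l} →
             k ≢ l → k ≤ᵢ l → (k , x) ≤ₗ (l , y)

  private
    ≤ₗ-trans : ∀ {u v w} → u ≤ₗ v → v ≤ₗ w → u ≤ₗ w
    ≤ₗ-trans (within p)   (within q)    = within (F.trans _ p q)
    ≤ₗ-trans (within _)   (across n q)  = across n q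
    ≤ₗ-trans (across n p) (within _)    = across n p
    ≤ₗ-trans (across n p) (across n′ q) =
      across (λ { refl → n (I.antisym p q) }) (I.trans p q)

    ≤ₗ-antisym : ∀ {u v} → u ≤ₗ v → v ≤ₗ u → u ≈ₗ v
    ≤ₗ-antisym (within p)   (within q)   = same (F.antisym _ p q)
    ≤ₗ-antisym (within _)   (across n _) = contradiction refl n
    ≤ₗ-antisym (across n _) (within _)   = contradiction refl n
    ≤ₗ-antisym (across n p) (across _ q) = contradiction (I.antisym p q) n

  lexSum : Poset (i ⊔ c) (i ⊔ c ⊔ ℓ₁) (i ⊔ ℓᵢ ⊔ c ⊔ ℓ₂)
  lexSum = record
    { Carrier = Union
    ; _≈_ = _≈ₗ_
    ; _≤_ = _≤ₗ_
    ; isPartialOrder = record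
      { isPreorder = record
        { isEquivalence = record
          { refl  = same (F.Eq.refl _)
          ; sym   = λ { (same p) → same (F.Eq.sym _ p) }
          ; trans = λ { (same p) (same q) → same (F.Eq.trans _ p q) }
          }
        ; reflexive = λ { (same p) → within (F.reflexive _ p) }
        ; trans = ≤ₗ-trans
        }
      ; antisym = ≤ₗ-antisym
      }
    }

_≅_ : ∀ {c′ ℓ₁′ ℓ₂′} → Poset c ℓ₁ ℓ₂ → Poset c′ ℓ₁′ ℓ₂′ →
      Set (c ⊔ ℓ₁ ⊔ ℓ₂ ⊔ c′ ⊔ ℓ₁′ ⊔ ℓ₂′)
P ≅ Q = ∃ (IsOrderIsomorphism P._≈_ Q._≈_ P._≤_ Q._≤_)
  where
  module P = Poset P
  module Q = Poset Q

-- P is the lexicographical sum of nonempty posets satisfying 𝒬, over an index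
-- poset with at least two elements which satisfies 𝒥.
IsLexSumOf : (IndexPoset c ℓ₂ → Set a) → (Poset c ℓ₁ ℓ₂ → Set ℓ) →
             Poset c ℓ₁ ℓ₂ → Set (suc (c ⊔ ℓ₁ ⊔ ℓ₂) ⊔ a ⊔ ℓ)
IsLexSumOf {c} {ℓ₂} {ℓ₁ = ℓ₁} 𝒥 𝒬 P =
  Σ (IndexPoset c ℓ₂) λ I →
  Σ (IndexPoset.Index I → Poset c ℓ₁ ℓ₂) λ F →
    AtLeastTwo (IndexPoset.poset I) ×
    𝒥 I ×
    (∀ k → Poset.Carrier (F k)) ×
    (∀ k → 𝒬 (F k)) ×
    (lexSum I F ≅ P)

IsLinearSumOf : (Poset c ℓ₁ ℓ₂ → Set ℓ) → Poset c ℓ₁ ℓ₂ → Set (suc (c ⊔ ℓ₁ ⊔ ℓ₂) ⊔ ℓ)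
IsLinearSumOf = IsLexSumOf (λ I → Total (IndexPoset._≤ᵢ_ I))

IsDisjointSumOf : (Poset c ℓ₁ ℓ₂ → Set ℓ) → Poset c ℓ₁ ℓ₂ → Set (suc (c ⊔ ℓ₁ ⊔ ℓ₂) ⊔ ℓ)
IsDisjointSumOf = IsLexSumOf (λ I → IsAntichain (IndexPoset.poset I) U)

NFreeNoInfiniteAntichain : Poset c ℓ₁ ℓ₂ → Set (suc (c ⊔ ℓ₁ ⊔ ℓ₂))
NFreeNoInfiniteAntichain P = NFree P × NoInfiniteAntichain P

{-# OPTIONS --safe #-}
-- The comparability graph of an N-free poset has no induced path on four
-- vertices. If it is disconnected, a connected component and its complement
-- form a disjoint sum; if its complement is disconnected, the elements above
-- some x outside the co-component of x form the top part of a linear sum. If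
-- both graphs were connected, one could enlarge an antichain forever: given an
-- antichain A and incomparable k, z with k comparable to all and z incomparable
-- to all of A, a comparability path from z to k yields w incomparable to
-- A ∪ {k} and v comparable to A ∪ {k , w}, and an incomparability path from v
-- to k then yields a pair k′, z′ of the same kind for A ∪ {w}. Iterating this
-- needs dependent choice, which is available because ExcludedMiddle produces an
-- element of every type that is not empty.
module Submission where

open import Defs
open import Axiom.ExcludedMiddle using (ExcludedMiddle)
open import Data.Bool.Base using (Bool; true; false)
import Data.Bool.Base as Bool
import Data.Bool.Properties as Bool
open import Data.Empty using (⊥)
open import Data.Fin.Base using (toℕ)
open import Data.Fin.Properties using (pigeonhole)
open import Data.List.Base using (List; []; _∷_; length)
open import Data.List.Relation.Unary.Any using (here; there; index)
open import Data.Nat.Base using (ℕ; zero; suc; _≤′_; ≤′-reflexive; ≤′-step)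
import Data.Nat.Base as ℕ
import Data.Nat.Properties as ℕ
open import Data.Product.Base using (∃; ∃₂; _×_; _,_; proj₁; proj₂; swap)
open import Data.Sum.Base using (_⊎_; inj₁; inj₂)
import Data.Sum.Base as Sum
open import Function.Base using (_∘_)
open import Function.Bundles using (mk⇔)
open import Level using (Level; _⊔_; 0ℓ; Lift; lift; lower)
open import Relation.Binary.Bundles using (Poset)
open import Relation.Binary.Core using (Rel)
open import Relation.Binary.Definitions using (Symmetric; tri<; tri≈; tri>)
open import Relation.Binary.Structures using (IsPartialOrder)
import Relation.Binary.Construct.On as On
open import Relation.Binary.Construct.Closure.Equivalence using (EqClosure)
open import Relation.Binary.Construct.Closure.ReflexiveTransitive
  using (Star; ε; _◅_; _◅◅_; reverse)
open import Relation.Binary.Construct.Closure.Symmetric as SymClosure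
  using (SymClosure; fwd; bwd)
open import Relation.Binary.PropositionalEquality.Core
  using (_≡_; _≢_; refl; sym; trans; cong)
import Relation.Binary.PropositionalEquality.Properties as ≡
import Relation.Binary.Properties.Setoid as SetoidProperties
open import Relation.Nullary.Decidable
  using (Dec; yes; no; does; map′; dec-true; dec-false; does-⇔; decidable-stable)
open import Relation.Nullary.Negation using (¬_; contradiction)
open import Relation.Unary using (Pred; _⊆_)
import Data.List.Membership.Setoid as SetoidMembership
open import Data.List.Membership.Setoid.Properties using (index-injective)

private
  variable
    a b p r c ℓ₁ ℓ₂ : Level

-- Classical tools.

lowerEM : ∀ b → ExcludedMiddle (a ⊔ b) → ExcludedMiddle a
lowerEM b em {A} = map′ lower lift (em {Lift b A})

-- A path that starts in `S` and ends outside it crosses the boundary of `S`. Connectedness is only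
-- ever used through such a crossing edge.
leave : {A : Set a} {R : Rel A r} {S : Pred A p} → (∀ x → Dec (S x)) →
        ∀ {x y} → Star R x y → S x → ¬ S y →
        ∃₂ λ u v → S u × ¬ S v × R u v
leave S? ε Sx ¬Sy = contradiction Sx ¬Sy
leave S? (_◅_ {j = v} Rxv path) Sx ¬Sy with S? v
... | yes Sv  = leave S? path Sv ¬Sy
... | no  ¬Sv = _ , v , Sx , ¬Sv , Rxv

counterexample : {A : Set a} {S : Pred A p} {B : Pred A r} →
                 ExcludedMiddle (a ⊔ p ⊔ r) → (∀ x → Dec (B x)) →
                 ¬ (∀ {x} → S x → B x) → ∃ λ x → S x × ¬ B x
counterexample em B? ¬all with em
... | yes found = found
... | no  ¬∃    =
  contradiction (λ {_} Sx → decidable-stable (B? _) λ ¬Bx → ¬∃ (_ , Sx , ¬Bx)) ¬all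

-- Properties inherited by subposets.

module _ (P : Poset c ℓ₁ ℓ₂) {B : Set c} (f : B → Poset.Carrier P) where
  private
    module P = Poset P
    module B = Poset (On.poset P f)
    open SetoidMembership P.Eq.setoid using () renaming (_∈_ to _∈ᴾ_)
    open SetoidMembership B.Eq.setoid using () renaming (_∈_ to _∈ᴮ_)

  NFree-on : NFree P → NFree (On.poset P f)
  NFree-on nfree x y z w n = nfree (f x) (f y) (f z) (f w) record
    { x<y = N.x<y ; z<y = N.z<y ; z<w = N.z<w
    ; x∥z = N.x∥z ; x∥w = N.x∥w ; y∥w = N.y∥w }
    where module N = IsN n

  -- One preimage per entry suffices: equality on `B` is pulled back along `f`, so all preimages of
  -- an entry are equal.
  listPreimage : ExcludedMiddle (c ⊔ ℓ₁) → (ys : List P.Carrier) →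
                 ∃ λ (xs : List B) → ∀ {x} → f x ∈ᴾ ys → x ∈ᴮ xs
  listPreimage em [] = [] , λ ()
  listPreimage em (y ∷ ys) with listPreimage em ys | em {∃ λ x → f x P.≈ y}
  ... | xs , covers | yes (x₀ , fx₀≈y) = x₀ ∷ xs , λ
    { (here fx≈y) → here (P.Eq.trans fx≈y (P.Eq.sym fx₀≈y))
    ; (there ∈ys) → there (covers ∈ys)
    }
  ... | xs , covers | no  ¬∃ = xs , λ
    { (here fx≈y) → contradiction (_ , fx≈y) ¬∃
    ; (there ∈ys) → covers ∈ys
    }

  NoInfiniteAntichain-on : ExcludedMiddle (c ⊔ ℓ₁) →
    NoInfiniteAntichain P → NoInfiniteAntichain (On.poset P f)
  NoInfiniteAntichain-on em none (S , antichain , infinite) =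
    none (image , imageAntichain , λ (ys , covers) →
      let xs , covers′ = listPreimage em ys
      in infinite (xs , λ Sx → covers′ (covers (_ , Sx , refl))))
    where
    image : Pred P.Carrier _
    image y = ∃ λ x → S x × f x ≡ y

    imageAntichain : IsAntichain P image
    imageAntichain (_ , Sx , refl) (_ , Sy , refl) = antichain Sx Sy

-- Lexicographical sums of the fibres of a map.

module _ (I : IndexPoset c ℓ₂) (P : Poset c ℓ₁ ℓ₂) where
  open IndexPoset I using (Index; _≤ᵢ_)
  private
    module P = Poset P
    module I = Poset (IndexPoset.poset I)

  module _ (class : P.Carrier → Index) where

    fibre : Index → Poset c ℓ₁ ℓ₂
    fibre k = On.poset P (proj₁ {B = λ x → class x ≡ k})

    lexSum-fibres : (∀ k l → Dec (k ≡ l)) →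
      (∀ {x y} → x P.≤ y → class x ≤ᵢ class y) →
      (∀ {x y} → class x ≢ class y → class x ≤ᵢ class y → x P.≤ y) →
      lexSum I fibre ≅ P
    lexSum-fibres _≟_ class-mono cross = element , record
      { isOrderMonomorphism = record
        { isOrderHomomorphism = record
          { cong = ≈-preserved
          ; mono = λ { (within x≤y) → x≤y
                     ; (across {x = _ , refl} {y = _ , refl} k≢l k≤l) → cross k≢l k≤l }
          }
        ; injective = injective
        ; cancel    = cancel
        }
      ; surjective = λ y → (class y , y , refl) , ≈-preserved
      }
      where
      element : Union I fibre → P.Carrier
      element (_ , x , _) = x

      ≈-preserved : ∀ {u v} → _≈ₗ_ I fibre u v → element u P.≈ element v
      ≈-preserved (same x≈y) = x≈y

      injective : ∀ {u v} → element u P.≈ element v → _≈ₗ_ I fibre u v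
      -- Equal elements lie below each other, so monotonicity and antisymmetry in the index put them
      -- in the same fibre.
      injective {_ , x , refl} {_ , y , eq} x≈y
        with refl ← trans (sym eq) (I.antisym (class-mono (P.reflexive (P.Eq.sym x≈y)))
                                    (class-mono (P.reflexive x≈y)))
        = same x≈y

      cancel : ∀ {u v} → element u P.≤ element v → _≤ₗ_ I fibre u v
      cancel {k , x , refl} {l , y , eq} x≤y with k ≟ l
      ... | yes refl = within x≤y
      ... | no  k≢l with refl ← eq = across k≢l (class-mono x≤y)

module _ {_⊑_ : Rel Bool 0ℓ} (⊑-isPartialOrder : IsPartialOrder _≡_ _⊑_) where
  private module ⊑ = IsPartialOrder ⊑-isPartialOrder

  -- Serves both kinds of sum: equality as `_⊑_` gives the antichain, the usual order of `Bool` the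
  -- chain. The lifts fit the levels that `IsLexSumOf` fixes.
  twoElement : IndexPoset c ℓ₂
  twoElement {c} {ℓ₂} = record
    { Index = Lift c Bool
    ; _≤ᵢ_  = λ i j → Lift ℓ₂ (lower i ⊑ lower j)
    ; isPartialOrder = record
      { isPreorder = record
        { isEquivalence = ≡.isEquivalence
        ; reflexive     = λ { refl → lift ⊑.refl }
        ; trans         = λ i⊑j j⊑k → lift (⊑.trans (lower i⊑j) (lower j⊑k))
        }
      ; antisym = λ i⊑j j⊑i → cong lift (⊑.antisym (lower i⊑j) (lower j⊑i))
      }
    }

-- The comparability graph and its complement.

module Comparability (P : Poset c ℓ₁ ℓ₂) where
  open Poset P

  _⌣_ : Rel Carrier ℓ₂
  _⌣_ = SymClosure _≤_

  _∥_ : Rel Carrier ℓ₂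
  _∥_ = Incomparable P

  -- Edges of the complement graph. The disjunct `≈` makes its components closed under the equality
  -- of the poset, since `ε` only joins identical elements.
  _≈∥_ : Rel Carrier (ℓ₁ ⊔ ℓ₂)
  x ≈∥ y = x ≈ y ⊎ x ∥ y

  ⌣-sym : Symmetric _⌣_
  ⌣-sym = SymClosure.symmetric _≤_

  ⌣-respʳ : ∀ {x y z} → y ≈ z → x ⌣ y → x ⌣ z
  ⌣-respʳ y≈z (fwd x≤y) = fwd (≤-respʳ-≈ y≈z x≤y)
  ⌣-respʳ y≈z (bwd y≤x) = bwd (≤-respˡ-≈ y≈z y≤x)

  ∥⇒¬⌣ : ∀ {x y} → x ∥ y → ¬ (x ⌣ y)
  ∥⇒¬⌣ (x≰y , _) (fwd x≤y) = x≰y x≤y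
  ∥⇒¬⌣ (_ , y≰x) (bwd y≤x) = y≰x y≤x

  ¬⌣⇒∥ : ∀ {x y} → ¬ (x ⌣ y) → x ∥ y
  ¬⌣⇒∥ ¬x⌣y = ¬x⌣y ∘ fwd , ¬x⌣y ∘ bwd

-- Decomposing when one of the graphs is disconnected.

module _ (em : ExcludedMiddle (c ⊔ ℓ₁ ⊔ ℓ₂)) (P : Poset c ℓ₁ ℓ₂)
         (nfree : NFree P) (noInfAC : NoInfiniteAntichain P) where
  open Poset P renaming (refl to ≤-refl; trans to ≤-trans)
  open Comparability P

  private
    L : Level
    L = c ⊔ ℓ₁ ⊔ ℓ₂

  -- The summands are `S`, labelled `true`, and its complement; both inherit the required properties
  -- as subposets.
  splitLexSum : {_⊑_ : Rel Bool 0ℓ} (po : IsPartialOrder _≡_ _⊑_)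
    (𝒥 : IndexPoset c ℓ₂ → Set a) → 𝒥 (twoElement po) →
    {S : Pred Carrier p} (S? : ∀ x → Dec (S x)) → ∃ S → ∃ (λ x → ¬ S x) →
    (∀ {x y} → x ≤ y → does (S? x) ⊑ does (S? y)) →
    (∀ {x y} → does (S? x) ≢ does (S? y) → does (S? x) ⊑ does (S? y) → x ≤ y) →
    IsLexSumOf 𝒥 NFreeNoInfiniteAntichain P
  splitLexSum po 𝒥 j S? (s , Ss) (t , ¬St) S-mono cross =
    twoElement po , fibre I P class , (lift false , lift true , λ ()) , j ,
    (λ { (lift true)  → s , cong lift (dec-true (S? s) Ss)
       ; (lift false) → t , cong lift (dec-false (S? t) ¬St) }) ,
    (λ k → NFree-on P proj₁ nfree ,
           NoInfiniteAntichain-on P proj₁ (lowerEM ℓ₂ em) noInfAC) ,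
    lexSum-fibres I P class (λ k l → map′ (cong lift) (cong lower) (lower k Bool.≟ lower l))
      (lift ∘ S-mono) (λ k≢l k≤l → cross (k≢l ∘ cong lift) (lower k≤l))
    where
    I = twoElement po

    class : Carrier → Lift c Bool
    class x = lift (does (S? x))

  _⌣?_ : ∀ x y → Dec (x ⌣ y)
  _ ⌣? _ = lowerEM L em

  _∥?_ : ∀ x y → Dec (x ∥ y)
  _ ∥? _ = lowerEM L em

  ¬∥⇒⌣ : ∀ {x y} → ¬ (x ∥ y) → x ⌣ y
  ¬∥⇒⌣ ¬x∥y = decidable-stable (_ ⌣? _) (¬x∥y ∘ ¬⌣⇒∥)

  disjointSum : ∀ {x y} → ¬ EqClosure _≤_ x y →
                IsDisjointSumOf NFreeNoInfiniteAntichain P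
  disjointSum {x} {y} ¬x~y =
    splitLexSum (SetoidProperties.≈-isPartialOrder (≡.setoid Bool)) _
      (λ {_} {_} _ _ i≢j → i≢j ∘ cong lift ∘ lower , i≢j ∘ sym ∘ cong lift ∘ lower)
      connected? (x , ε) (y , ¬x~y)
      -- A comparability extends paths in both directions, so comparable elements get the same
      -- label. As `_⊑_` is equality, the last condition is vacuous.
      (λ u≤v → does-⇔ (mk⇔ (_◅◅ (fwd u≤v ◅ ε)) (_◅◅ (bwd u≤v ◅ ε)))
                       (connected? _) (connected? _))
      (λ u≢v u≡v → contradiction u≡v u≢v)
    where
    connected? : ∀ z → Dec (EqClosure _≤_ x z)
    connected? _ = lowerEM ℓ₁ em

  -- Walk along the path, keeping the current vertex below `u`. If `x ∥ m`, then `m` is comparable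
  -- to `u`, or else `u` would join the co-component; and `u ≤ m` would give `x ≤ m`.
  below-co-component : ∀ {x l u} → x ≤ u → Star _≈∥_ x l →
                       ¬ Star _≈∥_ x u → l ≤ u
  below-co-component x≤u ε ¬x~u = x≤u
  below-co-component x≤u (_◅_ {j = m} (inj₁ x≈m) m~l) ¬x~u =
    below-co-component (≤-respˡ-≈ x≈m x≤u) m~l (¬x~u ∘ (inj₁ x≈m ◅_))
  below-co-component {u = u} x≤u (_◅_ {j = m} (inj₂ x∥m) m~l) ¬x~u
    with m ⌣? u
  ... | yes (fwd m≤u) = below-co-component m≤u m~l (¬x~u ∘ (inj₂ x∥m ◅_))
  ... | yes (bwd u≤m) = contradiction (≤-trans x≤u u≤m) (proj₁ x∥m)
  ... | no  ¬m⌣u      = contradiction (inj₂ x∥m ◅ inj₂ (¬⌣⇒∥ ¬m⌣u) ◅ ε) ¬x~u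

  linearSum-≤ : ∀ {x y} → x ≤ y → ¬ Star _≈∥_ x y →
                IsLinearSumOf NFreeNoInfiniteAntichain P
  linearSum-≤ {x} {y} x≤y ¬x~y =
    splitLexSum Bool.≤-isPartialOrder _
      (λ i j → Sum.map lift lift (Bool.≤-total (lower i) (lower j)))
      upper? (y , x≤y , ¬x~y) (x , λ (_ , ¬x~x) → ¬x~x ε)
      upper-mono cross
    where
    Upper : Pred Carrier L
    Upper z = x ≤ z × ¬ Star _≈∥_ x z

    upper? : ∀ z → Dec (Upper z)
    upper? _ = em

    -- Outside the co-component of `x`, the element `l` is comparable to `x`; `x ≤ l` would make it
    -- upper, so `l ≤ x ≤ u`.
    ¬upper≤upper : ∀ {l u} → ¬ Upper l → Upper u → l ≤ u
    ¬upper≤upper {l} ¬Ul (x≤u , ¬x~u) with em {Star _≈∥_ x l}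
    ... | yes x~l = below-co-component x≤u x~l ¬x~u
    ... | no ¬x~l with x ⌣? l
    ...   | yes (fwd x≤l) = contradiction (x≤l , ¬x~l) ¬Ul
    ...   | yes (bwd l≤x) = ≤-trans l≤x x≤u
    ...   | no  ¬x⌣l      = contradiction (inj₂ (¬⌣⇒∥ ¬x⌣l) ◅ ε) ¬x~l

    -- If `v` were in the co-component of `x`, it would lie below `u`, hence equal `u` and pull `u`
    -- into that co-component.
    upper-closed : ∀ {u v} → u ≤ v → Upper u → Upper v
    upper-closed u≤v (x≤u , ¬x~u) = ≤-trans x≤u u≤v , λ x~v →
      let v≤u = below-co-component x≤u x~v ¬x~u
      in ¬x~u (x~v ◅◅ (inj₁ (antisym v≤u u≤v) ◅ ε))

    upper-mono : ∀ {u v} → u ≤ v → does (upper? u) Bool.≤ does (upper? v)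
    upper-mono {u} {v} u≤v with upper? u | upper? v
    ... | yes _  | yes _  = Bool.b≤b
    ... | yes Uu | no ¬Uv = contradiction (upper-closed u≤v Uu) ¬Uv
    ... | no _   | yes _  = Bool.f≤t
    ... | no _   | no _   = Bool.b≤b

    cross : ∀ {u v} → does (upper? u) ≢ does (upper? v) →
            does (upper? u) Bool.≤ does (upper? v) → u ≤ v
    cross {u} {v} u≢v u⊑v with upper? u | upper? v | u⊑v
    ... | yes _  | yes _  | _  = contradiction refl u≢v
    ... | yes _  | no  _  | ()
    ... | no ¬Uu | yes Uv | _  = ¬upper≤upper ¬Uu Uv
    ... | no _   | no _   | _  = contradiction refl u≢v

  linearSum : ∀ {x y} → ¬ Star _≈∥_ x y → IsLinearSumOf NFreeNoInfiniteAntichain P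
  linearSum {x} {y} ¬x~y with x ⌣? y
  ... | yes (fwd x≤y) = linearSum-≤ x≤y ¬x~y
  ... | yes (bwd y≤x) = linearSum-≤ y≤x (¬x~y ∘ reverse (Sum.map Eq.sym swap))
  ... | no  ¬x⌣y      = contradiction (inj₂ (¬⌣⇒∥ ¬x⌣y) ◅ ε) ¬x~y

  -- Two consecutive edges in the same direction would make a non-edge comparable by transitivity.
  -- The two alternating orientations are an N read from either end; strictness comes from the
  -- non-edges.
  noP₄ : ∀ {x y z w} → x ⌣ y → y ⌣ z → z ⌣ w → x ∥ z → x ∥ w → y ∥ w → ⊥
  noP₄ (fwd x≤y) (fwd y≤z) _ x∥z _ _ = proj₁ x∥z (≤-trans x≤y y≤z)
  noP₄ (bwd y≤x) (bwd z≤y) _ x∥z _ _ = proj₂ x∥z (≤-trans z≤y y≤x)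
  noP₄ _ (fwd y≤z) (fwd z≤w) _ _ y∥w = proj₁ y∥w (≤-trans y≤z z≤w)
  noP₄ _ (bwd z≤y) (bwd w≤z) _ _ y∥w = proj₂ y∥w (≤-trans w≤z z≤y)
  noP₄ (fwd x≤y) (bwd z≤y) (fwd z≤w) x∥z x∥w y∥w = nfree _ _ _ _ record
    { x<y = x≤y , λ x≈y → proj₂ x∥z (≤-respʳ-≈ (Eq.sym x≈y) z≤y)
    ; z<y = z≤y , λ z≈y → proj₁ y∥w (≤-respˡ-≈ z≈y z≤w)
    ; z<w = z≤w , λ z≈w → proj₂ y∥w (≤-respˡ-≈ z≈w z≤y)
    ; x∥z = x∥z ; x∥w = x∥w ; y∥w = y∥w }
  noP₄ (bwd y≤x) (fwd y≤z) (bwd w≤z) x∥z x∥w y∥w = nfree _ _ _ _ record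
    { x<y = w≤z , λ w≈z → proj₁ y∥w (≤-respʳ-≈ (Eq.sym w≈z) y≤z)
    ; z<y = y≤z , λ y≈z → proj₂ x∥z (≤-respˡ-≈ y≈z y≤x)
    ; z<w = y≤x , λ y≈x → proj₁ x∥z (≤-respˡ-≈ y≈x y≤z)
    ; x∥z = swap y∥w ; x∥w = swap x∥w ; y∥w = swap x∥z }

  -- Growing an antichain when both graphs are connected.

  module _ (connected : ∀ x y → EqClosure _≤_ x y)
           (co-connected : ∀ x y → Star _≈∥_ x y) where

    record Extendable : Set (Level.suc L) where
      field
        A         : Pred Carrier L
        antichain : IsAntichain P A
        k z       : Carrier
        k⌣A       : ∀ {a} → A a → k ⌣ a
        z∥A       : ∀ {a} → A a → z ∥ a
        z∥k       : z ∥ k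

    Extends : Extendable → Carrier → Extendable → Set L
    Extends s w t =
      (∀ {a} → Extendable.A s a → w ∥ a) × Extendable.A s ⊆ Extendable.A t × Extendable.A t w

    extend : (s : Extendable) → ∃₂ (Extends s)
    extend s
      -- The comparability path from `z` to `k` leaves the set of elements incomparable to `A` and
      -- `k`, which omits `k` by reflexivity.
      with w , v , (w∥k , w∥A) , ¬Zv , w⌣v ←
        leave {S = λ u → u ∥ Extendable.k s × (∀ {a} → Extendable.A s a → u ∥ a)}
          (λ _ → em) (connected _ _) (Extendable.z∥k s , Extendable.z∥A s)
          (λ (k∥k , _) → proj₁ k∥k ≤-refl)
      -- The co-path from `v` to `k` leaves the set of elements comparable to all of `A′`: `k` is
      -- outside because of `w`.
      = enlarge (leave {S = λ u → ∀ {a} → A′ a → u ⌣ a} (λ _ → em)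
          (co-connected v k) v⌣A′ λ k⌣A′ → ∥⇒¬⌣ w∥k (⌣-sym (k⌣A′ w∈A′)))
      where
      open Extendable s

      A′ : Pred Carrier L
      A′ x = A x ⊎ Lift L (x ≈ w)

      w∈A′ : A′ w
      w∈A′ = inj₂ (lift Eq.refl)

      -- Otherwise `v` is comparable to some `a` in `A`, and `w`, `v`, `a`, `k` is an induced path.
      v⌣k : v ⌣ k
      v⌣k = ¬∥⇒⌣ λ v∥k →
        let a , Aa , ¬v∥a = counterexample em (v ∥?_) λ v∥A → ¬Zv (v∥k , v∥A)
        in noP₄ w⌣v (¬∥⇒⌣ ¬v∥a) (⌣-sym (k⌣A Aa)) (w∥A Aa) w∥k v∥k

      -- Otherwise `w`, `v`, `k`, `a` is an induced path.
      v⌣A : ∀ {a} → A a → v ⌣ a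
      v⌣A Aa = decidable-stable (_ ⌣? _) λ ¬v⌣a →
        noP₄ w⌣v v⌣k (k⌣A Aa) w∥k (w∥A Aa) (¬⌣⇒∥ ¬v⌣a)

      v⌣A′ : ∀ {a} → A′ a → v ⌣ a
      v⌣A′ (inj₁ Aa)         = v⌣A Aa
      v⌣A′ (inj₂ (lift a≈w)) = ⌣-respʳ (Eq.sym a≈w) (⌣-sym w⌣v)

      ≈w⇒∥A : ∀ {x a} → x ≈ w → A a → x ∥ a
      ≈w⇒∥A x≈w Aa = ¬⌣⇒∥ λ x⌣a → ∥⇒¬⌣ (w∥A Aa) (⌣-sym (⌣-respʳ x≈w (⌣-sym x⌣a)))

      antichain′ : IsAntichain P A′
      antichain′ (inj₁ Ax) (inj₁ Ay) x≉y = antichain Ax Ay x≉y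
      antichain′ (inj₁ Ax) (inj₂ (lift y≈w)) _ = swap (≈w⇒∥A y≈w Ax)
      antichain′ (inj₂ (lift x≈w)) (inj₁ Ay) _ = ≈w⇒∥A x≈w Ay
      antichain′ (inj₂ (lift x≈w)) (inj₂ (lift y≈w)) x≉y =
        contradiction (Eq.trans x≈w (Eq.sym y≈w)) x≉y

      enlarge : (∃₂ λ k′ z′ → (∀ {a} → A′ a → k′ ⌣ a) ×
                  ¬ (∀ {a} → A′ a → z′ ⌣ a) × k′ ≈∥ z′) →
                ∃₂ (Extends s)
      enlarge (_ , _ , k′⌣A′ , ¬z′⌣A′ , inj₁ k′≈z′) =
        contradiction (λ {_} A′a → ⌣-sym (⌣-respʳ k′≈z′ (⌣-sym (k′⌣A′ A′a)))) ¬z′⌣A′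
      enlarge (k′ , z′ , k′⌣A′ , ¬z′⌣A′ , inj₂ k′∥z′) = w , record
        { A = A′ ; antichain = antichain′ ; k = k′ ; z = z′
        ; k⌣A = k′⌣A′ ; z∥A = z′∥A′ ; z∥k = swap k′∥z′
        } , w∥A , inj₁ , w∈A′
        where
        -- Some `b` in `A′` is not comparable to `z′`. If `z′` were comparable to `a`, then `z′`,
        -- `a`, `k′`, `b` would be an induced path.
        z′∥A′ : ∀ {a} → A′ a → z′ ∥ a
        z′∥A′ A′a =
          let b , A′b , ¬z′⌣b = counterexample em (z′ ⌣?_) ¬z′⌣A′
          in ¬⌣⇒∥ λ z′⌣a →
            noP₄ z′⌣a (⌣-sym (k′⌣A′ A′a)) (k′⌣A′ A′b) (swap k′∥z′) (¬⌣⇒∥ ¬z′⌣b)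
              (antichain′ A′a A′b λ a≈b → ¬z′⌣b (⌣-respʳ a≈b z′⌣a))

    module _ (start : Extendable) where

      state : ℕ → Extendable
      state zero    = start
      state (suc n) = proj₁ (proj₂ (extend (state n)))

      new : ℕ → Carrier
      new n = proj₁ (extend (state n))

      extends : ∀ n → Extends (state n) (new n) (state (suc n))
      extends n = proj₂ (proj₂ (extend (state n)))

      new∈later : ∀ {m n} → suc m ≤′ n → Extendable.A (state n) (new m)
      new∈later {m} (≤′-reflexive refl) = proj₂ (proj₂ (extends m))
      new∈later {n = suc n} (≤′-step m<n) = proj₁ (proj₂ (extends n)) (new∈later m<n)

      new-∥ : ∀ {m n} → m ℕ.< n → new n ∥ new m
      new-∥ {n = n} m<n = proj₁ (extends n) (new∈later (ℕ.≤⇒≤′ m<n))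

      noExtendable : ⊥
      noExtendable = noInfAC (News , newsAntichain , newsInfinite)
        where
        News : Pred Carrier L
        News x = Lift L (∃ λ n → x ≈ new n)

        newsAntichain : IsAntichain P News
        newsAntichain (lift (m , x≈m)) (lift (n , y≈n)) x≉y =
          ¬⌣⇒∥ λ x⌣y → new-distinct (⌣-respʳ y≈n (⌣-sym (⌣-respʳ x≈m (⌣-sym x⌣y))))
          where
          new-distinct : ¬ (new m ⌣ new n)
          new-distinct with ℕ.<-cmp m n
          ... | tri< m<n _ _ = ∥⇒¬⌣ (swap (new-∥ m<n))
          ... | tri≈ _ refl _ = contradiction (Eq.trans x≈m (Eq.sym y≈n)) x≉y
          ... | tri> _ _ n<m = ∥⇒¬⌣ (new-∥ n<m)

        newsInfinite : Infinite P News
        newsInfinite (xs , covers)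
          -- Among the first `suc (length xs)` new elements, two share a position in `xs` and so are
          -- equal, though incomparable.
          with i , j , i<j , eq ← pigeonhole (ℕ.n<1+n (length xs))
                 (λ n → index (covers (lift (toℕ n , Eq.refl))))
          = proj₁ (new-∥ i<j) (reflexive (Eq.sym
              (index-injective Eq.setoid _ _ eq)))

    notBothConnected : AtLeastTwo P → ⊥
    notBothConnected (x , y , x≉y)
      -- The co-path leaves the class of `x` along an incomparable pair, which starts the iteration
      -- with the empty antichain.
      with leave {S = x ≈_} (λ _ → lowerEM L em) (co-connected x y) Eq.refl x≉y
    ... | u , v , x≈u , x≉v , inj₁ u≈v = x≉v (Eq.trans x≈u u≈v)
    ... | u , v , _   , _   , inj₂ u∥v = noExtendable record
      { A = λ _ → Lift L ⊥ ; antichain = λ () ; k = u ; z = v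
      ; k⌣A = λ () ; z∥A = λ () ; z∥k = swap u∥v }

theorem7 : ∀ {c ℓ₁ ℓ₂} → ExcludedMiddle (c ⊔ ℓ₁ ⊔ ℓ₂) →
    (P : Poset c ℓ₁ ℓ₂) → AtLeastTwo P → NFree P → NoInfiniteAntichain P →
    IsLinearSumOf NFreeNoInfiniteAntichain P ⊎ IsDisjointSumOf NFreeNoInfiniteAntichain P
theorem7 {ℓ₁ = ℓ₁} em P twoElements nfree noInfAC
  with em {∃₂ λ x y → ¬ Star (Comparability._≈∥_ P) x y}
     | lowerEM ℓ₁ em {∃₂ λ x y → ¬ EqClosure (Poset._≤_ P) x y}
... | yes (_ , _ , ¬x~y) | _ = inj₁ (linearSum em P nfree noInfAC ¬x~y)
... | no _ | yes (_ , _ , ¬x~y) = inj₂ (disjointSum em P nfree noInfAC ¬x~y)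
... | no co-connected | no connected = contradiction twoElements (notBothConnected em P nfree noInfAC
  (λ x y → decidable-stable (lowerEM ℓ₁ em) λ ¬x~y → connected (x , y , ¬x~y))
  (λ x y → decidable-stable em λ ¬x~y → co-connected (x , y , ¬x~y)))
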